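{- Let $\mathfrak{M}$ be a model, $f$ a Boolean expression in $n$ arguments, $x$ a variable, and $\iota,\varepsilon,\varphi_1,\dots,\varphi_n$ formulas such that $x$ does not occur free in $\iota$, each $\varphi_i$ is non-dependent of $x$ in $\mathfrak{M}$ provided $\iota\land\varepsilon$, and $\mathfrak{M}\models\exists x\varepsilon$. Let $u_1,\dots,u_k$ be variables and $Q_1,\dots,Q_k\in\{\forall,\exists\}$, let $\bar z$ be a list of variables with an arbitrary list $\bar Q$ of quantifiers (so $\bar Q\bar z$ is a block of quantifiers), where no variable of $\bar z$ occurs free in $\iota$ or $\varepsilon$, and $x$ is distinct from the $u_j$ and from the variables of $\bar z$. Then $$[\![(Q_1u_1\in\iota)\dots(Q_ku_k\in\iota)\,\bar Q\bar z\,f\big(\forall x(\varepsilon\to\varphi_1),\dots,\forall x(\varepsilon\to\varphi_n)\big)]\!]^{\mathfrak{M}}=[\![(Q_1u_1\in\iota)\dots(Q_ku_k\in\iota)\,\forall x\big(\varepsilon\to\bar Q\bar z\,f(\varphi_1,\dots,\varphi_n)\big)]\!]^{\mathfrak{M}}.$$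
   Context: Work in first-order logic with equality over a relational signature, with countably many variables $v_1,v_2,\dots$. A model $\mathfrak{M}$ has nonempty universe $M$; assignments are $\bar a\in M^\omega$ ($a_i$ is the value of $v_i$); for $x=v_i$, $b\in M$, $\bar a^x_b$ is $\bar a$ with $i$-th entry replaced by $b$. $[\![\varphi]\!]^{\mathfrak{M}}=\{\bar a\in M^\omega:\mathfrak{M}\models\varphi[\bar a]\}$; $\mathfrak{M}\models\chi$ means every $\bar a$ satisfies $\chi$. Bounded quantifiers: $(\forall u\in\phi)\,\psi$ abbreviates $\forall u(\phi\to\psi)$ and $(\exists u\in\phi)\,\psi$ abbreviates $\exists u(\phi\land\psi)$. A Boolean expression is built from its arguments using $\neg$ and $\land$. Definition: $\varphi$ is non-dependent of $x$ in $\mathfrak{M}$ provided $\theta$ iff for all $\bar a\in M^\omega$, $b\in M$: if $\mathfrak{M}\models\theta[\bar a]$ and $\mathfrak{M}\models\theta[\bar a^x_b]$ then ($\mathfrak{M}\models\varphi[\bar a]\iff\mathfrak{M}\models\varphi[\bar a^x_b]$). -}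

module Defs where

open import Data.Fin.Base using (Fin)
open import Data.List.Base using (List; foldr)
open import Data.List.NonEmpty.Base using (List⁺; toList)
open import Data.Nat.Base using (ℕ)
open import Data.Nat.Properties using (_≟_)
open import Data.Product.Base using (∃; _×_; _,_)
open import Data.Sum.Base using (_⊎_)
open import Data.Vec.Base using (Vec; map)
open import Data.Vec.Membership.Propositional using (_∈_)
open import Function.Bundles using (_⇔_)
open import Level using (Level; suc)
open import Relation.Binary.PropositionalEquality.Core using (_≡_; _≢_)
open import Relation.Nullary.Decidable.Core using (yes; no)
open import Relation.Nullary.Negation.Core using (¬_)
open import Relation.Unary using (Pred)

private variable
  s ℓ : Level

record Signature s : Set (suc s) where
  field
    Rel   : Set s
    arity : Rel → ℕ

open Signature public

Var : Set
Var = ℕ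

infix  8 _≈′_
infixr 7 _∧′_
infixr 6 _∨′_
infixr 5 _⇒′_

-- All the usual connectives and both quantifiers are primitive, so that each
-- receives its own Tarskian clause in the constructive metatheory, instead of
-- being a double-negation encoding of another.
data Formula (S : Signature s) : Set s where
  rel            : (R : Rel S) → Vec Var (arity S R) → Formula S
  _≈′_           : Var → Var → Formula S
  ¬′_            : Formula S → Formula S
  _∧′_ _∨′_ _⇒′_ : Formula S → Formula S → Formula S
  ∀′ ∃′          : Var → Formula S → Formula S

infix 9 ¬′_

private variable
  S : Signature s

infix 4 _FreeIn_

_FreeIn_ : Var → Formula S → Set
x FreeIn rel R ys = x ∈ ys
x FreeIn (y ≈′ z) = x ≡ y ⊎ x ≡ z
x FreeIn (¬′ φ)   = x FreeIn φ
x FreeIn (φ ∧′ ψ) = x FreeIn φ ⊎ x FreeIn ψ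
x FreeIn (φ ∨′ ψ) = x FreeIn φ ⊎ x FreeIn ψ
x FreeIn (φ ⇒′ ψ) = x FreeIn φ ⊎ x FreeIn ψ
x FreeIn ∀′ y φ   = x ≢ y × x FreeIn φ
x FreeIn ∃′ y φ   = x ≢ y × x FreeIn φ

record Model (S : Signature s) ℓ : Set (s Level.⊔ suc ℓ) where
  field
    Universe : Set ℓ
    nonempty : Universe
    interp   : (R : Rel S) → Pred (Vec Universe (arity S R)) ℓ

open Model public

Assignment : Model S ℓ → Set ℓ
Assignment M = Var → Universe M

_[_≔_] : {A : Set ℓ} → (Var → A) → Var → A → (Var → A)
(a [ x ≔ b ]) y with y ≟ x
... | yes _ = b
... | no  _ = a y

infix 4 _⊨_[_] _⊨_

_⊨_[_] : (M : Model S ℓ) → Formula S → Assignment M → Set ℓ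
M ⊨ rel R xs [ a ] = interp M R (map a xs)
M ⊨ x ≈′ y   [ a ] = a x ≡ a y
M ⊨ ¬′ φ     [ a ] = ¬ (M ⊨ φ [ a ])
M ⊨ φ ∧′ ψ   [ a ] = M ⊨ φ [ a ] × M ⊨ ψ [ a ]
M ⊨ φ ∨′ ψ   [ a ] = M ⊨ φ [ a ] ⊎ M ⊨ ψ [ a ]
M ⊨ φ ⇒′ ψ   [ a ] = M ⊨ φ [ a ] → M ⊨ ψ [ a ]
M ⊨ ∀′ x φ   [ a ] = ∀ b → M ⊨ φ [ a [ x ≔ b ] ]
M ⊨ ∃′ x φ   [ a ] = ∃ λ b → M ⊨ φ [ a [ x ≔ b ] ]

_⊨_ : Model S ℓ → Formula S → Set ℓ
M ⊨ φ = ∀ a → M ⊨ φ [ a ]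

⟦_⟧ : Formula S → (M : Model S ℓ) → Pred (Assignment M) ℓ
⟦ φ ⟧ M a = M ⊨ φ [ a ]

NonDependent : (M : Model S ℓ) → Formula S → Var → Formula S → Set ℓ
NonDependent M φ x θ = ∀ a b →
  M ⊨ θ [ a ] → M ⊨ θ [ a [ x ≔ b ] ] →
  (M ⊨ φ [ a ]) ⇔ (M ⊨ φ [ a [ x ≔ b ] ])

data BoolExpr (n : ℕ) : Set where
  arg  : Fin n → BoolExpr n
  neg  : BoolExpr n → BoolExpr n
  conj : BoolExpr n → BoolExpr n → BoolExpr n

infix 10 _⟨_⟩

_⟨_⟩ : ∀ {n} → BoolExpr n → (Fin n → Formula S) → Formula S
arg i    ⟨ φ ⟩ = φ i
neg f    ⟨ φ ⟩ = ¬′ (f ⟨ φ ⟩)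
conj f g ⟨ φ ⟩ = f ⟨ φ ⟩ ∧′ g ⟨ φ ⟩

data Quantifier : Set where
  all ex : Quantifier

quantify : Quantifier × Var → Formula S → Formula S
quantify (all , u) ψ = ∀′ u ψ
quantify (ex  , u) ψ = ∃′ u ψ

quantifyIn : Formula S → Quantifier × Var → Formula S → Formula S
quantifyIn φ (all , u) ψ = ∀′ u (φ ⇒′ ψ)
quantifyIn φ (ex  , u) ψ = ∃′ u (φ ∧′ ψ)

block : List (Quantifier × Var) → Formula S → Formula S
block Qz ψ = foldr quantify ψ Qz

-- The block is nonempty: with no quantifier bounded by φ, nothing would
-- relativise the matrix to φ.
blockIn : List⁺ (Quantifier × Var) → Formula S → Formula S → Formula S
blockIn Qu φ ψ = foldr (quantifyIn φ) ψ (toList Qu)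

{-# OPTIONS --safe #-}

-- At an assignment satisfying ι ∧ ε each φᵢ is equivalent to ∀x(ε → φᵢ), since
-- moving x inside ε does not change φᵢ; as the quantifiers z̄ preserve ι ∧ ε,
-- this passes through f and Q̄z̄. The formula Q̄z̄ f(∀x(ε → φ₁), …) does not
-- depend on x, so under ι it can be evaluated after moving x to any value in ε,
-- of which there is at least one.
module Submission where

open import Defs
open import Data.Fin.Base using (Fin)
open import Data.List.Base using (List; []; _∷_; foldr)
open import Data.List.NonEmpty.Base using (List⁺; toList; _∷_)
open import Data.List.Relation.Unary.All as All using (All; []; _∷_)
open import Data.Nat.Properties using (_≟_)
open import Data.Product.Base using (∃; _×_; _,_; proj₂; map₂)
open import Data.Product.Function.NonDependent.Propositional using (_×-⇔_)
open import Data.Sum.Base using (inj₁; inj₂; [_,_])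
open import Data.Sum.Function.Propositional using (_⊎-⇔_)
open import Data.Vec.Base using (Vec; []; _∷_; map)
import Data.Vec.Membership.Propositional as Vec
open import Data.Vec.Relation.Unary.Any using (here; there)
open import Function.Base using (_∘_)
open import Function.Bundles using (_⇔_; mk⇔; Equivalence)
open import Function.Properties.Equivalence using () renaming (trans to ⇔-trans)
open import Function.Related.TypeIsomorphisms using (→-cong-⇔; ¬-cong-⇔)
open import Level using (Level)
open import Relation.Binary.PropositionalEquality.Core
  using (_≡_; _≢_; refl; sym; trans; cong₂; subst)
open import Relation.Nullary.Decidable.Core using (yes; no)
open import Relation.Nullary.Negation.Core using (¬_; contradiction)
open import Relation.Unary using (_≐_)

open Equivalence using (to; from)

private variable
  s ℓ p q : Level
  A B : Set ℓ
  S : Signature s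

Π-cong-⇔ : {P : A → Set p} {Q : A → Set q} →
  (∀ x → P x ⇔ Q x) → (∀ x → P x) ⇔ (∀ x → Q x)
Π-cong-⇔ e = mk⇔ (λ f x → to (e x) (f x)) (λ g x → from (e x) (g x))

∃-cong-⇔ : {P : A → Set p} {Q : A → Set q} →
  (∀ x → P x ⇔ Q x) → ∃ P ⇔ ∃ Q
∃-cong-⇔ e = mk⇔ (map₂ (to (e _))) (map₂ (from (e _)))

map-cong-∈ : ∀ {n} {f g : A → B} (xs : Vec A n) →
  (∀ {x} → x Vec.∈ xs → f x ≡ g x) → map f xs ≡ map g xs
map-cong-∈ []       e = refl
map-cong-∈ (x ∷ xs) e = cong₂ _∷_ (e (here refl)) (map-cong-∈ xs (e ∘ there))

-- Agreement is asked for only away from `x`: under a quantifier binding `x`, nothing is known about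
-- the old values there, and the update overwrites both.
≔-cong : {a a′ : Var → A} (x : Var) (b : A) {y : Var} →
  (y ≢ x → a y ≡ a′ y) → (a [ x ≔ b ]) y ≡ (a′ [ x ≔ b ]) y
≔-cong x b {y} e with y ≟ x
... | yes _  = refl
... | no y≢x = e y≢x

≔-id : (a : Var → A) (x y : Var) → (a [ x ≔ a x ]) y ≡ a y
≔-id a x y with y ≟ x
... | yes refl = refl
... | no _     = refl

≔-≢ : (a : Var → A) {x y : Var} (b : A) → y ≢ x → a y ≡ (a [ x ≔ b ]) y
≔-≢ a {x} {y} b y≢x with y ≟ x
... | yes y≡x = contradiction y≡x y≢x
... | no _    = refl

-- Induction on the formula. It also stands in for function extensionality, letting satisfaction
-- pass between assignments that are only pointwise equal.
⊨-coincidence : (M : Model S ℓ) (φ : Formula S) {a a′ : Assignment M} →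
  (∀ {y} → y FreeIn φ → a y ≡ a′ y) → (M ⊨ φ [ a ]) ⇔ (M ⊨ φ [ a′ ])
⊨-coincidence M (rel R xs) e =
  mk⇔ (subst (interp M R) (map-cong-∈ xs e))
      (subst (interp M R) (sym (map-cong-∈ xs e)))
⊨-coincidence M (x ≈′ y) e =
  mk⇔ (λ p → trans (sym (e (inj₁ refl))) (trans p (e (inj₂ refl))))
      (λ p → trans (e (inj₁ refl)) (trans p (sym (e (inj₂ refl)))))
⊨-coincidence M (¬′ φ) e = ¬-cong-⇔ (⊨-coincidence M φ e)
⊨-coincidence M (φ ∧′ ψ) e =
  ⊨-coincidence M φ (e ∘ inj₁) ×-⇔ ⊨-coincidence M ψ (e ∘ inj₂)
⊨-coincidence M (φ ∨′ ψ) e =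
  ⊨-coincidence M φ (e ∘ inj₁) ⊎-⇔ ⊨-coincidence M ψ (e ∘ inj₂)
⊨-coincidence M (φ ⇒′ ψ) e =
  →-cong-⇔ (⊨-coincidence M φ (e ∘ inj₁)) (⊨-coincidence M ψ (e ∘ inj₂))
⊨-coincidence M (∀′ x φ) e = Π-cong-⇔ λ b →
  ⊨-coincidence M φ λ y∈φ → ≔-cong x b λ y≢x → e (y≢x , y∈φ)
⊨-coincidence M (∃′ x φ) e = ∃-cong-⇔ λ b →
  ⊨-coincidence M φ λ y∈φ → ≔-cong x b λ y≢x → e (y≢x , y∈φ)

⊨-≔-notFree : (M : Model S ℓ) (φ : Formula S) {x : Var} → ¬ (x FreeIn φ) →
  ∀ a b → (M ⊨ φ [ a ]) ⇔ (M ⊨ φ [ a [ x ≔ b ] ])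
⊨-≔-notFree M φ x∉φ a b =
  ⊨-coincidence M φ λ y∈φ → ≔-≢ a b λ { refl → x∉φ y∈φ }

notFree-block : ∀ {x} {ψ : Formula S} Qz → ¬ (x FreeIn ψ) → ¬ (x FreeIn block Qz ψ)
notFree-block []              x∉ψ = x∉ψ
notFree-block ((all , _) ∷ Qz) x∉ψ = notFree-block Qz x∉ψ ∘ proj₂
notFree-block ((ex  , _) ∷ Qz) x∉ψ = notFree-block Qz x∉ψ ∘ proj₂

notFree-⟨⟩ : ∀ {n x} (f : BoolExpr n) {φ : Fin n → Formula S} →
  (∀ i → ¬ (x FreeIn φ i)) → ¬ (x FreeIn f ⟨ φ ⟩)
notFree-⟨⟩ (arg i)    x∉φ = x∉φ i
notFree-⟨⟩ (neg f)    x∉φ = notFree-⟨⟩ f x∉φ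
notFree-⟨⟩ (conj f g) x∉φ = [ notFree-⟨⟩ f x∉φ , notFree-⟨⟩ g x∉φ ]

module _ (M : Model S ℓ) where

  ⟨⟩-cong : ∀ {n} (f : BoolExpr n) {φ ψ : Fin n → Formula S} {a} →
    (∀ i → (M ⊨ φ i [ a ]) ⇔ (M ⊨ ψ i [ a ])) →
    (M ⊨ f ⟨ φ ⟩ [ a ]) ⇔ (M ⊨ f ⟨ ψ ⟩ [ a ])
  ⟨⟩-cong (arg i)    e = e i
  ⟨⟩-cong (neg f)    e = ¬-cong-⇔ (⟨⟩-cong f e)
  ⟨⟩-cong (conj f g) e = ⟨⟩-cong f e ×-⇔ ⟨⟩-cong g e

  EquivalentUnder : Formula S → Formula S → Formula S → Set _
  EquivalentUnder θ φ ψ = ∀ a → M ⊨ θ [ a ] → (M ⊨ φ [ a ]) ⇔ (M ⊨ ψ [ a ])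

  -- The quantified variables are not free in `θ`, so whatever values they receive, `θ` still holds
  -- when the matrix is reached.
  block-cong : ∀ (θ : Formula S) {φ ψ Qz} → All (λ q → ¬ (proj₂ q FreeIn θ)) Qz →
    EquivalentUnder θ φ ψ → EquivalentUnder θ (block Qz φ) (block Qz ψ)
  block-cong θ [] e = e
  block-cong θ {Qz = (all , _) ∷ _} (z∉θ ∷ zs∉θ) e a θa = Π-cong-⇔ λ b →
    block-cong θ zs∉θ e _ (to (⊨-≔-notFree M θ z∉θ a b) θa)
  block-cong θ {Qz = (ex , _) ∷ _} (z∉θ ∷ zs∉θ) e a θa = ∃-cong-⇔ λ b →
    block-cong θ zs∉θ e _ (to (⊨-≔-notFree M θ z∉θ a b) θa)

  -- Here the variable may well be free in `θ`: the bound itself asserts `θ` at the new value, so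
  -- the equivalence comes out unconditional.
  quantifyIn-cong : ∀ {θ φ ψ : Formula S} q → EquivalentUnder θ φ ψ →
    ∀ a → (M ⊨ quantifyIn θ q φ [ a ]) ⇔ (M ⊨ quantifyIn θ q ψ [ a ])
  quantifyIn-cong (all , _) e a = Π-cong-⇔ λ b →
    mk⇔ (λ h θb → to (e _ θb) (h θb)) (λ h θb → from (e _ θb) (h θb))
  quantifyIn-cong (ex , _) e a = ∃-cong-⇔ λ b →
    mk⇔ (λ (θb , h) → θb , to (e _ θb) h) (λ (θb , h) → θb , from (e _ θb) h)

  foldr-quantifyIn-cong : ∀ {θ φ ψ : Formula S} Qu → EquivalentUnder θ φ ψ →
    EquivalentUnder θ (foldr (quantifyIn θ) φ Qu) (foldr (quantifyIn θ) ψ Qu)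
  foldr-quantifyIn-cong []       e      = e
  foldr-quantifyIn-cong (q ∷ Qu) e a θa =
    quantifyIn-cong q (foldr-quantifyIn-cong Qu e) a

  -- Nonemptiness of the block matters: its outermost quantifier discharges `θ`, whereas an empty
  -- block would leave an equivalence holding only under `θ`.
  blockIn-cong : ∀ {θ φ ψ : Formula S} Qu → EquivalentUnder θ φ ψ →
    ∀ a → (M ⊨ blockIn Qu θ φ [ a ]) ⇔ (M ⊨ blockIn Qu θ ψ [ a ])
  blockIn-cong (q ∷ Qu) e = quantifyIn-cong q (foldr-quantifyIn-cong Qu e)

  nonDependent⇒∀-⇔ : ∀ x (ι ε φ : Formula S) → ¬ (x FreeIn ι) →
    NonDependent M φ x (ι ∧′ ε) → EquivalentUnder (ι ∧′ ε) (∀′ x (ε ⇒′ φ)) φ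
  nonDependent⇒∀-⇔ x ι ε φ x∉ι nd a (ιa , εa) = mk⇔
    -- Instantiate at the current value of `x`, where `ε` is known to hold.
    (λ h → to (id-⇔ φ) (h (a x) (from (id-⇔ ε) εa)))
    -- Non-dependence carries `φ` from `a x` to `b`; its proviso at `b` holds because `ι` ignores
    -- the change of `x`.
    (λ φa b εb → to (nd a b (ιa , εa) (to (⊨-≔-notFree M ι x∉ι a b) ιa , εb)) φa)
    where
    id-⇔ : ∀ χ → (M ⊨ χ [ a [ x ≔ a x ] ]) ⇔ (M ⊨ χ [ a ])
    id-⇔ χ = ⊨-coincidence M χ λ _ → ≔-id a x _

  -- For every `b` in `ε`, the truth of `ψ` after moving `x` to `b` is that of `φ` at the original
  -- assignment, hence the same for all such `b`.
  ∀⇒-prenex : ∀ x (ι ε φ ψ : Formula S) → ¬ (x FreeIn ι) → ¬ (x FreeIn φ) →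
    M ⊨ ∃′ x ε → EquivalentUnder (ι ∧′ ε) φ ψ →
    EquivalentUnder ι φ (∀′ x (ε ⇒′ ψ))
  ∀⇒-prenex x ι ε φ ψ x∉ι x∉φ ∃ε e a ιa = mk⇔
    (λ φa b εb → to (shift b εb) φa)
    -- A witness of `ε` keeps the universal statement from being vacuous.
    (λ h → let b , εb = ∃ε a in from (shift b εb) (h b εb))
    where
    shift : ∀ b → M ⊨ ε [ a [ x ≔ b ] ] →
      (M ⊨ φ [ a ]) ⇔ (M ⊨ ψ [ a [ x ≔ b ] ])
    shift b εb = ⇔-trans (⊨-≔-notFree M φ x∉φ a b)
      (e _ (to (⊨-≔-notFree M ι x∉ι a b) ιa , εb))

mainTheorem15 : ∀ {s ℓ} {S : Signature s} (M : Model S ℓ)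
    {n} (f : BoolExpr n) (x : Var) (ι ε : Formula S) (φ : Fin n → Formula S) →
    ¬ (x FreeIn ι) →
    (∀ i → NonDependent M (φ i) x (ι ∧′ ε)) →
    M ⊨ ∃′ x ε →
    (Qu : List⁺ (Quantifier × Var)) (Qz : List (Quantifier × Var)) →
    All (λ q → ¬ (proj₂ q FreeIn ι) × ¬ (proj₂ q FreeIn ε)) Qz →
    All (λ q → x ≢ proj₂ q) (toList Qu) →
    All (λ q → x ≢ proj₂ q) Qz →
    ⟦ blockIn Qu ι (block Qz (f ⟨ (λ i → ∀′ x (ε ⇒′ φ i)) ⟩)) ⟧ M
    ≐ ⟦ blockIn Qu ι (∀′ x (ε ⇒′ block Qz (f ⟨ φ ⟩))) ⟧ M
mainTheorem15 {S = S} M f x ι ε φ x∉ι nd ∃ε Qu Qz z∉ _ _ =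
  (λ {a} → to (equiv a)) , (λ {a} → from (equiv a))
  where
  matrixˡ matrixʳ : Formula S
  matrixˡ = f ⟨ (λ i → ∀′ x (ε ⇒′ φ i)) ⟩
  matrixʳ = f ⟨ φ ⟩

  inner : EquivalentUnder M (ι ∧′ ε) (block Qz matrixˡ) (block Qz matrixʳ)
  inner = block-cong M (ι ∧′ ε) (All.map (λ (z∉ι , z∉ε) → [ z∉ι , z∉ε ]) z∉)
    λ a θa → ⟨⟩-cong M f λ i → nonDependent⇒∀-⇔ M x ι ε (φ i) x∉ι (nd i) a θa

  x∉matrixˡ : ¬ (x FreeIn matrixˡ)
  -- Each argument of `f` on the left begins with a quantifier binding `x`.
  x∉matrixˡ = notFree-⟨⟩ f λ _ (x≢x , _) → x≢x refl

  equiv : ∀ a →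
    (M ⊨ blockIn Qu ι (block Qz matrixˡ) [ a ]) ⇔
    (M ⊨ blockIn Qu ι (∀′ x (ε ⇒′ block Qz matrixʳ)) [ a ])
  -- The bounded quantifiers supply `ι`, so moving the quantifier on `x` outward is only required
  -- under `ι`.
  equiv = blockIn-cong M Qu (∀⇒-prenex M x ι ε (block Qz matrixˡ) (block Qz matrixʳ)
    x∉ι (notFree-block Qz x∉matrixˡ) ∃ε inner)
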